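{- Let $d\ge 2$ and $r\ge 3$ be integers and let $n=(r-1)(d+1)+1$. If $X\subset\mathbb{R}^d$ is a set with $|X|=n$ that is in a-general position, then $X$ is $r$-divisible.
   Context: A finite set $X=\{a_1,\ldots,a_m\}\subset\mathbb{R}^d$ of $m$ points is in a-general position if the $dm$ real numbers that are the coordinates of $a_1,\ldots,a_m$ are algebraically independent (over $\mathbb{Q}$). A finite set $X\subset\mathbb{R}^d$ is called $r$-divisible if there is a partition of $X$ into $r$ parts $X_1,\ldots,X_r$ (pairwise disjoint, with union $X$) such that $\bigcap_{p=1}^r \mathrm{conv}\, X_p\neq\emptyset$, where $\mathrm{conv}$ denotes the convex hull. -}

module Defs where

open import Algebra.Bundles using (CommutativeRing; module Semiring)
import Algebra.Definitions.RawSemiring as RawSemiringDefs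
open import Data.Bool.Base using (if_then_else_)
open import Data.Fin.Base using (Fin)
open import Data.Fin.Subset using (Subset; _∈_; _∉_; _∩_; Empty)
open import Data.Integer.Base using (ℤ; +_; -[1+_])
open import Data.List.Base using (List; []; _∷_)
open import Data.Nat.Base using (ℕ)
import Data.Nat.Properties as ℕₚ
open import Data.Product.Base using (Σ; ∃; _×_; _,_)
open import Data.Rational.Base as ℚ using (ℚ; 0ℚ)
open import Data.Vec.Base using (Vec; lookup)
open import Data.Vec.Functional using (Vector; concat)
import Data.Vec.Properties as Vecₚ
open import Function.Definitions using (Injective)
open import Level using (_⊔_)
open import Relation.Binary.Core using (Rel)
open import Relation.Binary.PropositionalEquality.Core using (_≡_; _≢_)
open import Relation.Binary.Structures using (IsDecTotalOrder)
open import Relation.Nullary using (¬_; does)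
open import Relation.Unary using (Pred; Satisfiable)

-- The classical axioms of a complete ordered field, which determine the real
-- numbers up to isomorphism.  The order is decidable, as it is classically, so
-- a model needs excluded middle.  The inverse is total, with no condition
-- imposed on 0# ⁻¹.
record RealNumbers c ℓ₁ ℓ₂ : Set (Level.suc (c ⊔ ℓ₁ ⊔ ℓ₂)) where
  infix  4 _≤_
  infix  9 _⁻¹
  field
    commutativeRing : CommutativeRing c ℓ₁

  open CommutativeRing commutativeRing public

  field
    0≉1             : ¬ (0# ≈ 1#)
    _⁻¹             : Carrier → Carrier
    *-inverseʳ      : ∀ x → ¬ (x ≈ 0#) → x * x ⁻¹ ≈ 1#
    _≤_             : Rel Carrier ℓ₂
    isDecTotalOrder : IsDecTotalOrder _≈_ _≤_
    +-monoʳ-≤       : ∀ x {y z} → y ≤ z → x + y ≤ x + z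
    *-nonneg        : ∀ {x y} → 0# ≤ x → 0# ≤ y → 0# ≤ x * y

  IsUpperBound : ∀ {p} → Pred Carrier p → Carrier → Set (c ⊔ ℓ₂ ⊔ p)
  IsUpperBound P u = ∀ {x} → P x → x ≤ u

  field
    supremum : (P : Pred Carrier (c ⊔ ℓ₁ ⊔ ℓ₂)) → Satisfiable P →
               ∃ (IsUpperBound P) →
               ∃ λ s → IsUpperBound P s × (∀ u → IsUpperBound P u → s ≤ u)

Monomial : ℕ → Set
Monomial k = Vec ℕ k

-- Polynomials over ℚ in k variables, as formal sums of terms in which the same
-- monomial may occur several times; `coeff` collects the occurrences.
Polynomial : ℕ → Set
Polynomial k = List (ℚ × Monomial k)

coeff : ∀ {k} → Polynomial k → Monomial k → ℚ
coeff []            e = 0ℚ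
coeff ((q , m) ∷ f) e =
  if does (Vecₚ.≡-dec ℕₚ._≟_ m e) then q ℚ.+ coeff f e else coeff f e

NonzeroPoly : ∀ {k} → Polynomial k → Set
NonzeroPoly f = ∃ λ e → coeff f e ≢ 0ℚ

module _ {c ℓ₁ ℓ₂} (ℝ : RealNumbers c ℓ₁ ℓ₂) where
  open RealNumbers ℝ
  open RawSemiringDefs (Semiring.rawSemiring semiring)
    using (sum; product; _^_) renaming (_×_ to _·_)

  fromℤ : ℤ → Carrier
  fromℤ (+ n)    = n · 1#
  fromℤ -[1+ n ] = - (ℕ.suc n · 1#)

  fromℚ : ℚ → Carrier
  fromℚ q = fromℤ (ℚ.numerator q) * fromℤ (ℚ.denominator q) ⁻¹

  evalMonomial : ∀ {k} → Monomial k → Vector Carrier k → Carrier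
  evalMonomial m x = product λ i → x i ^ lookup m i

  eval : ∀ {k} → Polynomial k → Vector Carrier k → Carrier
  eval []            x = 0#
  eval ((q , m) ∷ f) x = fromℚ q * evalMonomial m x + eval f x

  AlgebraicallyIndependent : ∀ {k} → Vector Carrier k → Set ℓ₁
  AlgebraicallyIndependent {k} x =
    (f : Polynomial k) → NonzeroPoly f → ¬ (eval f x ≈ 0#)

  Point : ℕ → Set c
  Point d = Vector Carrier d

  infix 4 _≋_
  _≋_ : ∀ {d} → Rel (Point d) ℓ₁
  x ≋ y = ∀ j → x j ≈ y j

  -- A set of exactly m points, listed without repetition.
  record PointSet (d m : ℕ) : Set (c ⊔ ℓ₁) where
    field
      point    : Fin m → Point d
      distinct : Injective _≡_ _≋_ point

  open PointSet

  AGeneralPosition : ∀ {d m} → PointSet d m → Set ℓ₁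
  AGeneralPosition X = AlgebraicallyIndependent (concat (point X))

  -- Subsets of X are given by sets of indices; since they are finite, their
  -- convex hull consists of the convex combinations of all their points.
  record InConv {d m} (X : PointSet d m) (S : Subset m) (z : Point d)
                : Set (c ⊔ ℓ₁ ⊔ ℓ₂) where
    field
      weight      : Vector Carrier m
      nonneg      : ∀ i → 0# ≤ weight i
      supported   : ∀ {i} → i ∉ S → weight i ≈ 0#
      total       : sum weight ≈ 1#
      combination : z ≋ λ j → sum λ i → weight i * point X i j

  record IsPartition {m r} (part : Fin r → Subset m) : Set where
    field
      disjoint : ∀ {p q} → p ≢ q → Empty (part p ∩ part q)
      covers   : ∀ i → ∃ λ p → i ∈ part p

  Divisible : ∀ {d m} → ℕ → PointSet d m → Set (c ⊔ ℓ₁ ⊔ ℓ₂)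
  Divisible {d} {m} r X =
    Σ (Fin r → Subset m) λ part →
      IsPartition part × ∃ λ (z : Point d) → ∀ p → InConv X (part p) z

{-# OPTIONS --safe #-}
module Submission where

-- This is an instance of Tverberg's theorem, here proved along the lines of
-- Sarkaria, by reduction to the colourful Carathéodory theorem of Bárány.
--
-- Let N = (r - 1)(d + 1) + 1 and write a′ = (a , 1) for a point a.  Each point
-- a is replaced by r vectors of dimension N, namely (v j ⊗ a′ , [ j = 0 ]) for
-- j < r, where v 0 = (-1, ..., -1) and the other v j are the unit vectors of
-- dimension r - 1 (`tensor`).  As the v j add up to 0, these r vectors add up
-- to b = (0 , 1), whatever a is (`sum-tensor`).  So b lies in each of N cones in
-- dimension N, one for each point of X.  By the colourful Carathéodory theorem
-- (`colourful`), one vector can be chosen from each of the N families in such a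
-- way that b lies in the cone of the chosen vectors.  The choice assigns an
-- index j to each point, that is, it partitions X into r parts.  The
-- coordinates of the equation for b say that the sum of the weighted vectors a′
-- over a part is the same for all parts, and that the weights of part 0 sum up
-- to 1 (`partition-by`).  Hence all parts have weight 1 and share a convex
-- combination.
--
-- The colourful Carathéodory theorem is proved by descent.  For a choice of at
-- most one vector of each colour, consider the point nearest to b in the span
-- of the chosen vectors.  If it lies in their cone, the choice is called good.
--
--   * `relax`: any point in the cone of a choice can be moved to the nearest
--     point of a good choice without going away from b.
--   * `exchange`: a good choice which does not reach b can be improved.  Its
--     residual ρ satisfies ρ ∙ ρ > 0 and is orthogonal to the chosen vectors.
--     N vectors orthogonal to ρ are linearly dependent, so that some colour can
--     be made superfluous without moving the nearest point (`free-colour`).  As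
--     ρ ∙ b = ρ ∙ ρ > 0 and b is in the cone of that colour, one of its vectors
--     u has ρ ∙ u > 0 (`improving`).  Adding a suitable multiple of u
--     decreases the distance to b, and relaxing again gives a good choice.
--
-- There are finitely many choices and the distance to b of the nearest point
-- depends only on the choice, so the improvement must stop, at b.

open import Defs

import Algebra.Properties.AbelianGroup
import Algebra.Properties.Ring
import Algebra.Properties.Semiring.Mult.TCOptimised
import Algebra.Properties.Semiring.Sum
import Algebra.Solver.Ring
open import Algebra.Solver.Ring.AlmostCommutativeRing
  using (_-Raw-AlmostCommutative⟶_; fromCommutativeRing)
open import Data.Bool.Base using (if_then_else_)
open import Data.Fin.Base
  using (Fin; zero; suc; punchIn; finToFun; funToFin; combine; quotient; remainder; _↑ˡ_; _↑ʳ_)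
open import Data.Fin.Induction using (spo-wellFounded)
open import Data.Fin.Properties as Finₚ using (punchInᵢ≢i)
open import Data.Fin.Subset using (Subset; _∈_; _∩_; Empty)
open import Data.Fin.Subset.Properties using (x∈p∩q⁻)
open import Data.Integer.Base as ℤ using (ℤ; +_; -[1+_]; +[1+_])
import Data.Integer.Properties as ℤₚ
open import Data.Maybe.Base using (Maybe; map)
open import Data.Nat.Base as ℕ using (ℕ; zero; suc)
import Data.Nat.Properties as ℕₚ
open import Data.Product.Base using (∃; _×_; _,_; proj₁; proj₂)
open import Data.Sum.Base using (_⊎_; inj₁; inj₂)
open import Data.Vec.Base using (tabulate)
open import Data.Vec.Functional using (Vector; removeAt; insertAt; updateAt; _∷_; _++_)
open import Data.Vec.Functional.Properties
  using (insertAt-lookup; insertAt-punchIn; updateAt-updates; updateAt-minimal;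
         lookup-++ˡ; lookup-++ʳ)
open import Data.Vec.Properties using (lookup∘tabulate; lookup⇒[]=; []=⇒lookup)
open import Function.Base using (_∘_; const)
open import Induction.WellFounded using (Acc; acc)
open import Level using (_⊔_)
open import Relation.Binary.PropositionalEquality.Core as ≡ using (_≡_; _≢_)
import Relation.Binary.PropositionalEquality.Properties as ≡
import Relation.Binary.Reasoning.Setoid
open import Relation.Binary.Structures using (IsDecTotalOrder; IsStrictPartialOrder)
open import Relation.Nullary using (¬_; yes; no; contradiction; does)
open import Relation.Nullary.Decidable using (dec-true; dec⇒maybe; ¬?; decidable-stable)

module _ {c ℓ₁ ℓ₂} (ℝ : RealNumbers c ℓ₁ ℓ₂) where
  open RealNumbers ℝ hiding (zero)
  open Algebra.Properties.Ring ring using (-‿distribˡ-*; -‿distribʳ-*; -‿involutive; -0#≈0#)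
  open Algebra.Properties.AbelianGroup +-abelianGroup using (⁻¹-∙-comm)
  open Algebra.Properties.Semiring.Mult.TCOptimised semiring
    using (×-homo-+; ×1-homo-*) renaming (_×_ to _·_)
  open Algebra.Properties.Semiring.Sum semiring
    using (sum; sum-cong-≋; sum-remove; sum-replicate-zero; ∑-distrib-+; ∑-comm;
           *-distribˡ-sum)
  open Relation.Binary.Reasoning.Setoid setoid

  private module ≤ = IsDecTotalOrder isDecTotalOrder

  -- The ring solver with integer coefficients

  private
    -- The multiplication by numerals is the optimised one, so that 1 denotes
    -- 1# up to definitional equality.
    ⟦_⟧ℤ : ℤ → Carrier
    ⟦ + n ⟧ℤ      = n · 1#
    ⟦ -[1+ n ] ⟧ℤ = - (suc n · 1#)

    -‿homo : ∀ i → ⟦ ℤ.- i ⟧ℤ ≈ - ⟦ i ⟧ℤ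
    -‿homo (+ zero)   = sym -0#≈0#
    -‿homo +[1+ n ]   = refl
    -‿homo (-[1+ n ]) = sym (-‿involutive _)

    cancel-1+ : ∀ x y → x + - y ≈ (1# + x) + - (1# + y)
    cancel-1+ x y = sym (begin
      (1# + x) + - (1# + y)     ≈⟨ +-cong (+-comm _ _) (sym (⁻¹-∙-comm _ _)) ⟩
      (x + 1#) + (- 1# + - y)   ≈⟨ +-assoc _ _ _ ⟩
      x + (1# + (- 1# + - y))   ≈⟨ +-congˡ (+-assoc _ _ _) ⟨
      x + ((1# + - 1#) + - y)   ≈⟨ +-congˡ (+-congʳ (-‿inverseʳ _)) ⟩
      x + (0# + - y)            ≈⟨ +-congˡ (+-identityˡ _) ⟩
      x + - y                   ∎)

    ⊖-homo : ∀ m n → ⟦ m ℤ.⊖ n ⟧ℤ ≈ m · 1# + - (n · 1#)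
    ⊖-homo zero    zero    = sym (trans (+-identityˡ _) -0#≈0#)
    ⊖-homo (suc m) zero    = sym (trans (+-congˡ -0#≈0#) (+-identityʳ _))
    ⊖-homo zero    (suc n) = sym (+-identityˡ _)
    ⊖-homo (suc m) (suc n) = begin
      ⟦ suc m ℤ.⊖ suc n ⟧ℤ             ≡⟨ ≡.cong ⟦_⟧ℤ (ℤₚ.[1+m]⊖[1+n]≡m⊖n m n) ⟩
      ⟦ m ℤ.⊖ n ⟧ℤ                     ≈⟨ ⊖-homo m n ⟩
      m · 1# + - (n · 1#)              ≈⟨ cancel-1+ _ _ ⟩
      (1# + m · 1#) + - (1# + n · 1#)  ≈⟨ +-cong (×-homo-+ 1# 1 m) (-‿cong (×-homo-+ 1# 1 n)) ⟨
      suc m · 1# + - (suc n · 1#)      ∎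

    +-homo : ∀ i j → ⟦ i ℤ.+ j ⟧ℤ ≈ ⟦ i ⟧ℤ + ⟦ j ⟧ℤ
    +-homo (+ m)      (+ n)      = ×-homo-+ 1# m n
    +-homo (+ m)      (-[1+ n ]) = ⊖-homo m (suc n)
    +-homo (-[1+ m ]) (+ n)      = trans (⊖-homo n (suc m)) (+-comm _ _)
    +-homo (-[1+ m ]) (-[1+ n ]) = begin
      - (suc (suc (m ℕ.+ n)) · 1#)        ≡⟨ ≡.cong (λ k → - (suc k · 1#)) (ℕₚ.+-suc m n) ⟨
      - ((suc m ℕ.+ suc n) · 1#)          ≈⟨ -‿cong (×-homo-+ 1# (suc m) (suc n)) ⟩
      - (suc m · 1# + suc n · 1#)         ≈⟨ ⁻¹-∙-comm _ _ ⟨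
      - (suc m · 1#) + - (suc n · 1#)     ∎

    *-homo⁺ : ∀ m j → ⟦ + m ℤ.* j ⟧ℤ ≈ ⟦ + m ⟧ℤ * ⟦ j ⟧ℤ
    *-homo⁺ m (+ n)      = begin
      ⟦ + m ℤ.* + n ⟧ℤ     ≡⟨ ≡.cong ⟦_⟧ℤ (ℤₚ.pos-* m n) ⟨
      (m ℕ.* n) · 1#       ≈⟨ ×1-homo-* m n ⟩
      m · 1# * (n · 1#)    ∎
    *-homo⁺ m (-[1+ n ]) = begin
      ⟦ + m ℤ.* -[1+ n ] ⟧ℤ          ≡⟨ ≡.cong ⟦_⟧ℤ (ℤₚ.neg-distribʳ-* (+ m) +[1+ n ]) ⟨
      ⟦ ℤ.- (+ m ℤ.* +[1+ n ]) ⟧ℤ    ≈⟨ -‿homo (+ m ℤ.* +[1+ n ]) ⟩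
      - ⟦ + m ℤ.* +[1+ n ] ⟧ℤ        ≈⟨ -‿cong (*-homo⁺ m (+ suc n)) ⟩
      - (m · 1# * (suc n · 1#))      ≈⟨ -‿distribʳ-* _ _ ⟩
      m · 1# * - (suc n · 1#)        ∎

    *-homo : ∀ i j → ⟦ i ℤ.* j ⟧ℤ ≈ ⟦ i ⟧ℤ * ⟦ j ⟧ℤ
    *-homo (+ m)      j = *-homo⁺ m j
    *-homo (-[1+ m ]) j = begin
      ⟦ -[1+ m ] ℤ.* j ⟧ℤ         ≡⟨ ≡.cong ⟦_⟧ℤ (ℤₚ.neg-distribˡ-* +[1+ m ] j) ⟨
      ⟦ ℤ.- (+[1+ m ] ℤ.* j) ⟧ℤ   ≈⟨ -‿homo (+[1+ m ] ℤ.* j) ⟩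
      - ⟦ +[1+ m ] ℤ.* j ⟧ℤ       ≈⟨ -‿cong (*-homo⁺ (suc m) j) ⟩
      - (suc m · 1# * ⟦ j ⟧ℤ)     ≈⟨ -‿distribˡ-* _ _ ⟩
      - (suc m · 1#) * ⟦ j ⟧ℤ     ∎

    ℤ⟶ℝ : ℤ.+-*-rawRing -Raw-AlmostCommutative⟶ fromCommutativeRing commutativeRing
    ℤ⟶ℝ = record
      { ⟦_⟧    = ⟦_⟧ℤ
      ; +-homo = +-homo
      ; *-homo = *-homo
      ; -‿homo = -‿homo
      ; 0-homo = refl
      ; 1-homo = refl
      }

    ⟦⟧ℤ-≟ : ∀ i j → Maybe (⟦ i ⟧ℤ ≈ ⟦ j ⟧ℤ)
    ⟦⟧ℤ-≟ i j = map (λ i≡j → reflexive (≡.cong ⟦_⟧ℤ i≡j)) (dec⇒maybe (i ℤₚ.≟ j))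

  open Algebra.Solver.Ring ℤ.+-*-rawRing (fromCommutativeRing commutativeRing) ℤ⟶ℝ ⟦⟧ℤ-≟
    using (solve; _:=_; _:+_; _:*_; _:-_; :-_; con)


  -- Ordered fields

  infix 4 _<_

  -- As the order is decidable and total, this is the usual strict order.
  _<_ : Carrier → Carrier → Set ℓ₂
  x < y = ¬ (y ≤ x)

  ≤-resp : ∀ {x x′ y y′} → x ≈ x′ → y ≈ y′ → x ≤ y → x′ ≤ y′
  ≤-resp x≈x′ y≈y′ x≤y = ≤.≤-respʳ-≈ y≈y′ (≤.≤-respˡ-≈ x≈x′ x≤y)

  <⇒≤ : ∀ {x y} → x < y → x ≤ y
  <⇒≤ {x} {y} y≰x with ≤.total x y
  ... | inj₁ x≤y = x≤y
  ... | inj₂ y≤x = contradiction y≤x y≰x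

  +-nonneg : ∀ {x y} → 0# ≤ x → 0# ≤ y → 0# ≤ x + y
  +-nonneg {x} {y} 0≤x 0≤y =
    ≤.trans 0≤x (≤-resp (+-identityʳ x) refl (+-monoʳ-≤ x 0≤y))

  ≤⇒0≤y-x : ∀ {x y} → x ≤ y → 0# ≤ y - x
  ≤⇒0≤y-x {x} {y} x≤y = ≤-resp (-‿inverseˡ x) (+-comm (- x) y) (+-monoʳ-≤ (- x) x≤y)

  0≤y-x⇒≤ : ∀ {x y} → 0# ≤ y - x → x ≤ y
  0≤y-x⇒≤ {x} {y} 0≤y-x = ≤-resp (+-identityʳ x)
    (solve 2 (λ x y → x :+ (y :- x) := y) refl x y) (+-monoʳ-≤ x 0≤y-x)

  nonpos⇒0≤- : ∀ {x} → x ≤ 0# → 0# ≤ - x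
  nonpos⇒0≤- {x} x≤0 = ≤-resp refl (+-identityˡ (- x)) (≤⇒0≤y-x x≤0)

  0≤-⇒nonpos : ∀ {x} → 0# ≤ - x → x ≤ 0#
  0≤-⇒nonpos {x} 0≤-x = 0≤y-x⇒≤ (≤-resp refl (sym (+-identityˡ (- x))) 0≤-x)

  x≤x+y : ∀ {x y} → 0# ≤ y → x ≤ x + y
  x≤x+y {x} 0≤y = ≤-resp (+-identityʳ x) refl (+-monoʳ-≤ x 0≤y)

  square-nonneg : ∀ x → 0# ≤ x * x
  square-nonneg x with ≤.total 0# x
  ... | inj₁ 0≤x = *-nonneg 0≤x 0≤x
  ... | inj₂ x≤0 = ≤-resp refl (solve 1 (λ x → :- x :* :- x := x :* x) refl x)
                     (*-nonneg (nonpos⇒0≤- x≤0) (nonpos⇒0≤- x≤0))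

  0≤1 : 0# ≤ 1#
  0≤1 = ≤-resp refl (*-identityʳ 1#) (square-nonneg 1#)

  *-cancel-0 : ∀ {x y} → ¬ (x ≈ 0#) → x * y ≈ 0# → y ≈ 0#
  *-cancel-0 {x} {y} x≉0 xy≈0 = begin
    y                ≈⟨ *-identityˡ y ⟨
    1# * y           ≈⟨ *-congʳ (*-inverseʳ x x≉0) ⟨
    x * x ⁻¹ * y     ≈⟨ solve 3 (λ x i y → x :* i :* y := i :* (x :* y)) refl x (x ⁻¹) y ⟩
    x ⁻¹ * (x * y)   ≈⟨ *-congˡ xy≈0 ⟩
    x ⁻¹ * 0#        ≈⟨ zeroʳ _ ⟩
    0#               ∎

  square-0 : ∀ {x} → x * x ≈ 0# → x ≈ 0#
  square-0 {x} xx≈0 with x ≤.≟ 0#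
  ... | yes x≈0 = x≈0
  ... | no  x≉0 = *-cancel-0 x≉0 xx≈0

  ⁻¹-nonneg : ∀ {x} → ¬ (x ≈ 0#) → 0# ≤ x → 0# ≤ x ⁻¹
  ⁻¹-nonneg {x} x≉0 0≤x = ≤-resp refl
    (trans (sym (*-assoc x _ _)) (trans (*-congʳ (*-inverseʳ x x≉0)) (*-identityˡ _)))
    (*-nonneg 0≤x (square-nonneg (x ⁻¹)))

  x/y*y≈x : ∀ x {y} → ¬ (y ≈ 0#) → x * y ⁻¹ * y ≈ x
  x/y*y≈x x {y} y≉0 = begin
    x * y ⁻¹ * y     ≈⟨ solve 3 (λ x i y → x :* i :* y := x :* (y :* i)) refl x (y ⁻¹) y ⟩
    x * (y * y ⁻¹)   ≈⟨ *-congˡ (*-inverseʳ y y≉0) ⟩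
    x * 1#           ≈⟨ *-identityʳ x ⟩
    x                ∎

  -- Division that also allows 0 / 0, with value 0.
  divide : ∀ x y → (y ≈ 0# → x ≈ 0#) → ∃ λ s → (s * y ≈ x) × (y ≈ 0# → s ≈ 0#)
  divide x y y≈0⇒x≈0 with y ≤.≟ 0#
  ... | yes y≈0 = 0# , trans (zeroˡ y) (sym (y≈0⇒x≈0 y≈0)) , λ _ → refl
  ... | no  y≉0 = x * y ⁻¹ , x/y*y≈x x y≉0 , λ y≈0 → contradiction y≈0 y≉0

  divide-nonneg : ∀ {x y} → 0# ≤ x → 0# < y → ∃ λ s → (s * y ≈ x) × 0# ≤ s
  divide-nonneg {x} {y} 0≤x 0<y =
    x * y ⁻¹ , x/y*y≈x x y≉0 , *-nonneg 0≤x (⁻¹-nonneg y≉0 (<⇒≤ 0<y))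
    where
    y≉0 : ¬ (y ≈ 0#)
    y≉0 y≈0 = 0<y (≤.reflexive y≈0)

  -- Finite sums

  *-zeroˡ-≈ : ∀ {x} y → x ≈ 0# → x * y ≈ 0#
  *-zeroˡ-≈ y x≈0 = trans (*-congʳ x≈0) (zeroˡ y)

  *-zeroʳ-≈ : ∀ x {y} → y ≈ 0# → x * y ≈ 0#
  *-zeroʳ-≈ x y≈0 = trans (*-congˡ y≈0) (zeroʳ x)

  sum-0 : ∀ {n} {f : Vector Carrier n} → (∀ i → f i ≈ 0#) → sum f ≈ 0#
  sum-0 {n} f≈0 = trans (sum-cong-≋ f≈0) (sum-replicate-zero n)

  sum-nonneg : ∀ {n} {f : Vector Carrier n} → (∀ i → 0# ≤ f i) → 0# ≤ sum f
  sum-nonneg {zero}  0≤f = ≤.refl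
  sum-nonneg {suc n} 0≤f = +-nonneg (0≤f zero) (sum-nonneg (0≤f ∘ suc))

  sum-nonpos : ∀ {n} {f : Vector Carrier n} → (∀ i → f i ≤ 0#) → sum f ≤ 0#
  sum-nonpos {zero}  f≤0 = ≤.refl
  sum-nonpos {suc n} {f} f≤0 =
    ≤.trans (≤-resp refl (+-identityʳ _) (+-monoʳ-≤ (f zero) (sum-nonpos (f≤0 ∘ suc)))) (f≤0 zero)

  sum-nonneg-0 : ∀ {n} {f : Vector Carrier n} → (∀ i → 0# ≤ f i) → sum f ≈ 0# → ∀ i → f i ≈ 0#
  sum-nonneg-0 {suc n} {f} 0≤f Σf≈0 = λ where
      zero    → f₀≈0
      (suc i) → sum-nonneg-0 (0≤f ∘ suc)
                  (trans (sym (+-identityˡ _)) (trans (+-congʳ (sym f₀≈0)) Σf≈0)) i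
    where
    f₀≈0 : f zero ≈ 0#
    f₀≈0 = ≤.antisym (≤-resp refl Σf≈0 (x≤x+y (sum-nonneg (0≤f ∘ suc)))) (0≤f zero)

  -- Changing a summand that vanishes adds the new summand to the sum.
  sum-replace : ∀ {n} {f g : Vector Carrier n} i → (∀ j → j ≢ i → f j ≈ g j) → g i ≈ 0# →
                sum f ≈ sum g + f i
  sum-replace {suc n} {f} {g} i f≈g gᵢ≈0 = begin
    sum f                          ≈⟨ sum-remove {i = i} f ⟩
    f i + sum (removeAt f i)       ≈⟨ +-comm _ _ ⟩
    sum (removeAt f i) + f i       ≈⟨ +-congʳ (sum-cong-≋ λ j → f≈g _ (punchInᵢ≢i i j)) ⟩
    sum (removeAt g i) + f i       ≈⟨ +-congʳ (+-identityˡ _) ⟨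
    0# + sum (removeAt g i) + f i  ≈⟨ +-congʳ (+-congʳ gᵢ≈0) ⟨
    g i + sum (removeAt g i) + f i ≈⟨ +-congʳ (sum-remove {i = i} g) ⟨
    sum g + f i                    ∎

  -- Linear combinations and the inner product

  Vec : ℕ → Set c
  Vec = Vector Carrier

  infix 8 _∙_

  _∙_ : ∀ {m} → Vec m → Vec m → Carrier
  x ∙ y = sum λ c → x c * y c

  -- The linear combination of the vectors U i with the coefficients w i.
  comb : ∀ {k m} → Vec k → (Fin k → Vec m) → Vec m
  comb w U c = sum λ i → w i * U i c

  ∙-cong : ∀ {m} {x x′ y y′ : Vec m} → (∀ c → x c ≈ x′ c) → (∀ c → y c ≈ y′ c) →
           x ∙ y ≈ x′ ∙ y′
  ∙-cong x≈x′ y≈y′ = sum-cong-≋ λ c → *-cong (x≈x′ c) (y≈y′ c)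

  ∙-comm : ∀ {m} (x y : Vec m) → x ∙ y ≈ y ∙ x
  ∙-comm x y = sum-cong-≋ λ c → *-comm (x c) (y c)

  ∙-+* : ∀ {m} (x y z : Vec m) t → (λ c → x c + t * y c) ∙ z ≈ x ∙ z + t * y ∙ z
  ∙-+* x y z t = begin
    sum (λ c → (x c + t * y c) * z c)
      ≈⟨ sum-cong-≋ (λ c → solve 4 (λ x y z t → (x :+ t :* y) :* z := x :* z :+ t :* (y :* z))
           refl (x c) (y c) (z c) t) ⟩
    sum (λ c → x c * z c + t * (y c * z c))
      ≈⟨ ∑-distrib-+ (λ c → x c * z c) (λ c → t * (y c * z c)) ⟩
    x ∙ z + sum (λ c → t * (y c * z c))
      ≈⟨ +-congˡ (*-distribˡ-sum t (λ c → y c * z c)) ⟨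
    x ∙ z + t * y ∙ z ∎

  comb-+* : ∀ {k m} (w δ : Vec k) (U : Fin k → Vec m) t c →
            comb (λ i → w i + t * δ i) U c ≈ comb w U c + t * comb δ U c
  comb-+* w δ U t c = ∙-+* w δ (λ i → U i c) t

  ∙-distribˡ-+ : ∀ {m} (x y z : Vec m) → x ∙ (λ c → y c + z c) ≈ x ∙ y + x ∙ z
  ∙-distribˡ-+ x y z = trans (sum-cong-≋ λ c → distribˡ (x c) (y c) (z c))
    (∑-distrib-+ (λ c → x c * y c) (λ c → x c * z c))

  ∙-comb : ∀ {k m} (x : Vec m) (w : Vec k) (U : Fin k → Vec m) →
           x ∙ comb w U ≈ sum λ i → w i * x ∙ U i
  ∙-comb x w U = begin
    sum (λ c → x c * comb w U c)
      ≈⟨ sum-cong-≋ (λ c → *-distribˡ-sum (x c) (λ i → w i * U i c)) ⟩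
    sum (λ c → sum λ i → x c * (w i * U i c))
      ≈⟨ ∑-comm (λ c i → x c * (w i * U i c)) ⟩
    sum (λ i → sum λ c → x c * (w i * U i c))
      ≈⟨ sum-cong-≋ (λ i → sum-cong-≋ λ c →
           solve 3 (λ x w u → x :* (w :* u) := w :* (x :* u)) refl (x c) (w i) (U i c)) ⟩
    sum (λ i → sum λ c → w i * (x c * U i c))
      ≈⟨ sum-cong-≋ (λ i → *-distribˡ-sum (w i) (λ c → x c * U i c)) ⟨
    sum (λ i → w i * x ∙ U i) ∎

  ∙-comb-⊥ : ∀ {k m} (x : Vec m) (w : Vec k) (U : Fin k → Vec m) →
             (∀ i → x ∙ U i ≈ 0#) → x ∙ comb w U ≈ 0#
  ∙-comb-⊥ x w U x⊥U = trans (∙-comb x w U) (sum-0 λ i → *-zeroʳ-≈ (w i) (x⊥U i))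

  norm²-nonneg : ∀ {m} (x : Vec m) → 0# ≤ x ∙ x
  norm²-nonneg x = sum-nonneg λ c → square-nonneg (x c)

  norm²-0 : ∀ {m} (x : Vec m) → x ∙ x ≈ 0# → ∀ c → x c ≈ 0#
  norm²-0 x xx≈0 c = square-0 (sum-nonneg-0 (λ c → square-nonneg (x c)) xx≈0 c)

  norm²-+* : ∀ {m} (x y : Vec m) t → let z = λ c → x c + t * y c in
             z ∙ z ≈ x ∙ x + (t * x ∙ y + t * x ∙ y) + t * t * y ∙ y
  norm²-+* x y t = begin
    z ∙ z                         ≈⟨ ∙-+* x y z t ⟩
    x ∙ z + t * y ∙ z             ≈⟨ +-cong (∙-comm x z) (*-congˡ (∙-comm y z)) ⟩
    z ∙ x + t * z ∙ y             ≈⟨ +-cong (∙-+* x y x t) (*-congˡ (∙-+* x y y t)) ⟩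
    x ∙ x + t * y ∙ x + t * (x ∙ y + t * y ∙ y)
      ≈⟨ +-congʳ (+-congˡ (*-congˡ (∙-comm y x))) ⟩
    x ∙ x + t * x ∙ y + t * (x ∙ y + t * y ∙ y)
      ≈⟨ solve 4 (λ a b d t → a :+ t :* b :+ t :* (b :+ t :* d) :=
                              a :+ (t :* b :+ t :* b) :+ t :* t :* d) refl (x ∙ x) (x ∙ y) (y ∙ y) t ⟩
    x ∙ x + (t * x ∙ y + t * x ∙ y) + t * t * y ∙ y ∎
    where
    z = λ c → x c + t * y c

  -- Linear algebra: orthogonal projection and linear dependence

  -- Coefficients of the orthogonal projection of b to the span of the U i,
  -- and the residual of b.  The coefficients are unique only if the U i are
  -- linearly independent; those of zero vectors are chosen to vanish.
  record Projection {k m} (U : Fin k → Vec m) (b : Vec m) : Set (c ⊔ ℓ₁) where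
    field
      weight    : Vec k
      residual  : Vec m
      decompose : ∀ c → b c ≈ comb weight U c + residual c
      residual⊥ : ∀ i → residual ∙ U i ≈ 0#
      vanishing : ∀ i → (∀ c → U i c ≈ 0#) → weight i ≈ 0#

  -- Gram-Schmidt: the first vector is replaced by its own residual with
  -- respect to the others.
  project : ∀ {k m} (U : Fin k → Vec m) (b : Vec m) → Projection U b
  project {zero}  U b = record
    { weight    = λ ()
    ; residual  = b
    ; decompose = λ c → sym (+-identityˡ (b c))
    ; residual⊥ = λ ()
    ; vanishing = λ ()
    }
  project {suc k} {m} U b = record
    { weight    = weight
    ; residual  = residual
    ; decompose = decompose
    ; residual⊥ = residual⊥
    ; vanishing = vanishing
    }
    where
    module P = Projection (project (U ∘ suc) b)
    module Q = Projection (project (U ∘ suc) (U zero))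

    division : ∃ λ s → (s * Q.residual ∙ Q.residual ≈ P.residual ∙ Q.residual)
                     × (Q.residual ∙ Q.residual ≈ 0# → s ≈ 0#)
    division = divide _ _ λ N≈0 → sum-0 λ c → *-zeroʳ-≈ (P.residual c) (norm²-0 Q.residual N≈0 c)

    s : Carrier
    s = proj₁ division

    weight : Vec (suc k)
    weight zero    = s
    weight (suc i) = P.weight i + - s * Q.weight i

    residual : Vec m
    residual c = P.residual c + - s * Q.residual c

    decompose : ∀ c → b c ≈ comb weight U c + residual c
    decompose c = begin
      b c                                             ≈⟨ P.decompose c ⟩
      p + P.residual c
        ≈⟨ solve 5 (λ p q x y s → p :+ x := (s :* (q :+ y) :+ (p :+ :- s :* q)) :+ (x :+ :- s :* y))
             refl p q (P.residual c) (Q.residual c) s ⟩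
      (s * (q + Q.residual c) + (p + - s * q)) + residual c
        ≈⟨ +-congʳ (+-cong (*-congˡ (Q.decompose c)) (comb-+* P.weight Q.weight (U ∘ suc) (- s) c)) ⟨
      comb weight U c + residual c                    ∎
      where
      p = comb P.weight (U ∘ suc) c
      q = comb Q.weight (U ∘ suc) c

    residual⊥-suc : ∀ i → residual ∙ U (suc i) ≈ 0#
    residual⊥-suc i = begin
      residual ∙ U (suc i)                                       ≈⟨ ∙-+* P.residual Q.residual _ (- s) ⟩
      P.residual ∙ U (suc i) + - s * Q.residual ∙ U (suc i)      ≈⟨ +-cong (P.residual⊥ i) (*-congˡ (Q.residual⊥ i)) ⟩
      0# + - s * 0#                                              ≈⟨ trans (+-identityˡ _) (zeroʳ _) ⟩
      0#                                                         ∎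

    -- The vectors orthogonal to the other U i do not distinguish U zero from
    -- its residual.
    ∙U₀ : ∀ x → (∀ i → x ∙ U (suc i) ≈ 0#) → x ∙ U zero ≈ x ∙ Q.residual
    ∙U₀ x x⊥U = begin
      x ∙ U zero                                            ≈⟨ ∙-cong {x = x} (λ _ → refl) Q.decompose ⟩
      x ∙ (λ c → comb Q.weight (U ∘ suc) c + Q.residual c)  ≈⟨ ∙-distribˡ-+ x _ _ ⟩
      x ∙ comb Q.weight (U ∘ suc) + x ∙ Q.residual          ≈⟨ +-congʳ (∙-comb-⊥ x Q.weight _ x⊥U) ⟩
      0# + x ∙ Q.residual                                   ≈⟨ +-identityˡ _ ⟩
      x ∙ Q.residual                                        ∎

    residual⊥ : ∀ i → residual ∙ U i ≈ 0#
    residual⊥ zero    = begin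
      residual ∙ U zero                                      ≈⟨ ∙U₀ residual residual⊥-suc ⟩
      residual ∙ Q.residual                                  ≈⟨ ∙-+* P.residual Q.residual _ (- s) ⟩
      P.residual ∙ Q.residual + - s * Q.residual ∙ Q.residual ≈⟨ +-congʳ (proj₁ (proj₂ division)) ⟨
      s * Q.residual ∙ Q.residual + - s * Q.residual ∙ Q.residual
        ≈⟨ solve 2 (λ s N → s :* N :+ :- s :* N := con (+ 0)) refl s _ ⟩
      0#                                                     ∎
    residual⊥ (suc i) = residual⊥-suc i

    vanishing : ∀ i → (∀ c → U i c ≈ 0#) → weight i ≈ 0#
    vanishing zero    U₀≈0 = proj₂ (proj₂ division) (trans (sym (∙U₀ Q.residual Q.residual⊥))
                               (sum-0 λ c → *-zeroʳ-≈ (Q.residual c) (U₀≈0 c)))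
    vanishing (suc i) Uᵢ≈0 = trans (+-cong (P.vanishing i Uᵢ≈0) (*-congˡ (Q.vanishing i Uᵢ≈0)))
                               (trans (+-identityˡ _) (zeroʳ _))

  -- Any n + 1 vectors in dimension n are linearly dependent, by Gaussian
  -- elimination of the first coordinate with a pivot p.
  dependent : ∀ {n} (A : Fin (suc n) → Vec n) →
              ∃ λ μ → (∃ λ i → ¬ (μ i ≈ 0#)) × (∀ c → comb μ A c ≈ 0#)
  dependent {zero}  A = const 1# , (zero , λ 1≈0 → 0≉1 (sym 1≈0)) , λ ()
  dependent {suc n} A with Finₚ.any? (λ i → ¬? (A i zero ≤.≟ 0#))
  ... | no  none = let
      A₀≈0 : ∀ i → A i zero ≈ 0#
      A₀≈0 i = decidable-stable (A i zero ≤.≟ 0#) λ Aᵢ≉0 → none (i , Aᵢ≉0)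
      μ , (i , μᵢ≉0) , Σ≈0 = dependent (λ k → A (suc k) ∘ suc)
    in 0# ∷ μ , (suc i , μᵢ≉0) , λ where
      zero    → sum-0 λ i → *-zeroʳ-≈ ((0# ∷ μ) i) (A₀≈0 i)
      (suc c) → trans (+-congʳ (zeroˡ _)) (trans (+-identityˡ _) (Σ≈0 c))
  ... | yes (p , Aₚ≉0) = μ , (punchIn p i , μᵢ≉0) , Σμ
    where
    ratio : Vec (suc n)
    ratio k = A (punchIn p k) zero * A p zero ⁻¹

    B : Fin (suc n) → Vec (suc n)
    B k c = A (punchIn p k) c + - ratio k * A p c

    IH = dependent (λ k → B k ∘ suc)
    ν  = proj₁ IH
    i  = proj₁ (proj₁ (proj₂ IH))

    σ : Carrier
    σ = sum λ k → ν k * ratio k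

    μ : Vec (suc (suc n))
    μ = insertAt ν p (- σ)

    μᵢ≉0 : ¬ (μ (punchIn p i) ≈ 0#)
    μᵢ≉0 μᵢ≈0 = proj₂ (proj₁ (proj₂ IH))
      (trans (reflexive (≡.sym (insertAt-punchIn ν p (- σ) i))) μᵢ≈0)

    ΣB : ∀ c → comb ν B c ≈ 0#
    ΣB zero    = sum-0 λ k → *-zeroʳ-≈ (ν k) (begin
      B k zero                                            ≈⟨ +-congˡ (-‿distribˡ-* _ _) ⟨
      A (punchIn p k) zero + - (ratio k * A p zero)       ≈⟨ +-congˡ (-‿cong (x/y*y≈x _ Aₚ≉0)) ⟩
      A (punchIn p k) zero + - A (punchIn p k) zero       ≈⟨ -‿inverseʳ _ ⟩
      0#                                                  ∎)
    ΣB (suc c) = proj₂ (proj₂ IH) c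

    Σμ : ∀ c → comb μ A c ≈ 0#
    Σμ c = begin
      comb μ A c
        ≈⟨ sum-remove {i = p} (λ k → μ k * A k c) ⟩
      μ p * A p c + sum (λ k → μ (punchIn p k) * A (punchIn p k) c)
        ≈⟨ +-cong (*-congʳ (reflexive (insertAt-lookup ν p (- σ))))
             (sum-cong-≋ λ k → *-congʳ {A (punchIn p k) c} (reflexive (insertAt-punchIn ν p (- σ) k))) ⟩
      - σ * A p c + sum (λ k → ν k * A (punchIn p k) c)
        ≈⟨ solve 3 (λ σ a x → :- σ :* a :+ x := x :+ :- a :* σ) refl σ (A p c) _ ⟩
      sum (λ k → ν k * A (punchIn p k) c) + - A p c * σ
        ≈⟨ +-congˡ (*-distribˡ-sum (- A p c) (λ k → ν k * ratio k)) ⟩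
      sum (λ k → ν k * A (punchIn p k) c) + sum (λ k → - A p c * (ν k * ratio k))
        ≈⟨ ∑-distrib-+ (λ k → ν k * A (punchIn p k) c) (λ k → - A p c * (ν k * ratio k)) ⟨
      sum (λ k → ν k * A (punchIn p k) c + - A p c * (ν k * ratio k))
        ≈⟨ sum-cong-≋ (λ k → solve 4 (λ v x a r → v :* x :+ :- a :* (v :* r) := v :* (x :+ :- r :* a))
             refl (ν k) (A (punchIn p k) c) (A p c) (ratio k)) ⟩
      comb ν B c
        ≈⟨ ΣB c ⟩
      0# ∎

  -- In dimension n, there is room for n - 1 independent vectors in a
  -- hyperplane.  The dependence is scaled to have a negative coefficient.
  dependent-⊥ : ∀ {n} (x : Vec n) (U : Fin n → Vec n) → ¬ (x ∙ x ≈ 0#) → (∀ i → x ∙ U i ≈ 0#) →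
                ∃ λ μ → (∃ λ i → μ i < 0#) × (∀ c → comb μ U c ≈ 0#)
  dependent-⊥ {n} x U xx≉0 x⊥U with dependent (x ∷ U)
  ... | ν , (i , νᵢ≉0) , Σν≈0 = μ , (negative i νᵢ≉0) , Σμ≈0
    where
    ν₀≈0 : ν zero ≈ 0#
    ν₀≈0 = *-cancel-0 xx≉0 (begin
      x ∙ x * ν zero                          ≈⟨ trans (*-comm _ _) (sym (+-identityʳ _)) ⟩
      ν zero * x ∙ x + 0#                     ≈⟨ +-congˡ (sum-0 λ i → *-zeroʳ-≈ (ν (suc i)) (x⊥U i)) ⟨
      sum (λ i → ν i * x ∙ (x ∷ U) i)         ≈⟨ ∙-comb x ν (x ∷ U) ⟨
      x ∙ comb ν (x ∷ U)                      ≈⟨ sum-0 (λ c → *-zeroʳ-≈ (x c) (Σν≈0 c)) ⟩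
      0#                                      ∎)

    μ : Vec n
    μ j = - ν i * ν (suc j)

    negative : ∀ i → ¬ (ν i ≈ 0#) → ∃ λ j → - ν i * ν (suc j) < 0#
    negative zero    ν₀≉0 = contradiction ν₀≈0 ν₀≉0
    negative (suc j) νⱼ≉0 = j , λ 0≤-νⱼ² → νⱼ≉0 (square-0 (≤.antisym
      (0≤-⇒nonpos (≤-resp refl (sym (-‿distribˡ-* _ _)) 0≤-νⱼ²)) (square-nonneg _)))

    Σμ≈0 : ∀ c → comb μ U c ≈ 0#
    Σμ≈0 c = begin
      comb μ U c                              ≈⟨ sum-cong-≋ (λ j → *-assoc (- ν i) (ν (suc j)) (U j c)) ⟩
      sum (λ j → - ν i * (ν (suc j) * U j c)) ≈⟨ *-distribˡ-sum (- ν i) (λ j → ν (suc j) * U j c) ⟨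
      - ν i * comb (ν ∘ suc) U c              ≈⟨ *-congˡ (+-identityˡ _) ⟨
      - ν i * (0# + comb (ν ∘ suc) U c)       ≈⟨ *-congˡ (+-congʳ (*-zeroˡ-≈ _ ν₀≈0)) ⟨
      - ν i * comb ν (x ∷ U) c                ≈⟨ *-zeroʳ-≈ _ (Σν≈0 c) ⟩
      0#                                      ∎

  -- Leaving the nonnegative orthant along a ray

  -- A parameter s between 0 and t keeps a coordinate nonnegative if t does.
  +*-between : ∀ {w δ s t} → s ≤ t → 0# ≤ s → 0# ≤ w → 0# ≤ w + t * δ → 0# ≤ w + s * δ
  +*-between {w} {δ} {s} {t} s≤t 0≤s 0≤w 0≤w+tδ with ≤.total 0# δ
  ... | inj₁ 0≤δ = +-nonneg 0≤w (*-nonneg 0≤s 0≤δ)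
  ... | inj₂ δ≤0 = ≤-resp refl
    (solve 4 (λ w δ s t → w :+ t :* δ :+ (t :- s) :* (:- δ) := w :+ s :* δ) refl w δ s t)
    (+-nonneg 0≤w+tδ (*-nonneg (≤⇒0≤y-x s≤t) (nonpos⇒0≤- δ≤0)))

  -- The ray w + t δ, which starts in the orthant, leaves it at the parameter t
  -- through the facet i.
  record Exit {n} (w δ : Vec n) : Set (c ⊔ ℓ₁ ⊔ ℓ₂) where
    field
      t        : Carrier
      0≤t      : 0# ≤ t
      inside   : ∀ i → 0# ≤ w i + t * δ i
      i        : Fin n
      δᵢ<0     : δ i < 0#
      boundary : w i + t * δ i ≈ 0#

  exit : ∀ {n} (w δ : Vec n) → (∀ i → 0# ≤ w i) → (∀ i → 0# ≤ δ i) ⊎ Exit w δ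
  exit {zero}  w δ 0≤w = inj₁ λ ()
  exit {suc n} w δ 0≤w = extend (exit (w ∘ suc) (δ ∘ suc) (0≤w ∘ suc))
    where
    -- The exit through the facet 0, if the other facets have not been crossed.
    exit₀ : δ zero < 0# →
            (∀ t → 0# ≤ t → w zero + t * δ zero ≈ 0# → ∀ i → 0# ≤ w (suc i) + t * δ (suc i)) →
            Exit w δ
    exit₀ δ₀<0 inside₀ with divide-nonneg (0≤w zero)
      (λ -δ₀≤0 → δ₀<0 (≤-resp refl (-‿involutive _) (nonpos⇒0≤- -δ₀≤0)))
    ... | t , t*-δ₀≈w₀ , 0≤t = record
      { t        = t
      ; 0≤t      = 0≤t
      ; inside   = λ where
          zero    → ≤.reflexive (sym boundary)
          (suc i) → inside₀ t 0≤t boundary i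
      ; i        = zero
      ; δᵢ<0     = δ₀<0
      ; boundary = boundary
      }
      where
      boundary : w zero + t * δ zero ≈ 0#
      boundary = trans (+-congʳ (sym t*-δ₀≈w₀))
        (solve 2 (λ t d → t :* (:- d) :+ t :* d := con (+ 0)) refl t (δ zero))

    extend : (∀ i → 0# ≤ δ (suc i)) ⊎ Exit (w ∘ suc) (δ ∘ suc) → (∀ i → 0# ≤ δ i) ⊎ Exit w δ
    extend (inj₁ 0≤δ) with 0# ≤.≤? δ zero
    ... | yes 0≤δ₀ = inj₁ λ where
      zero    → 0≤δ₀
      (suc i) → 0≤δ i
    ... | no  δ₀<0 = inj₂ (exit₀ δ₀<0 λ t 0≤t _ i → +-nonneg (0≤w (suc i)) (*-nonneg 0≤t (0≤δ i)))
    extend (inj₂ e) with 0# ≤.≤? (w zero + Exit.t e * δ zero)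
    ... | yes 0≤ = inj₂ record
      { t        = t
      ; 0≤t      = 0≤t
      ; inside   = λ where
          zero    → 0≤
          (suc i) → inside i
      ; i        = suc i
      ; δᵢ<0     = δᵢ<0
      ; boundary = boundary
      }
      where open Exit e
    ... | no  ≱0 = inj₂ (exit₀ (λ 0≤δ₀ → ≱0 (+-nonneg (0≤w zero) (*-nonneg 0≤t 0≤δ₀))) inside₀)
      where
      open Exit e
      inside₀ : ∀ s → 0# ≤ s → w zero + s * δ zero ≈ 0# → ∀ i → 0# ≤ w (suc i) + s * δ (suc i)
      inside₀ s 0≤s w₀+sδ₀≈0 i with ≤.total s t
      ... | inj₁ s≤t = +*-between s≤t 0≤s (0≤w (suc i)) (inside i)
      ... | inj₂ t≤s = contradiction
        (+*-between t≤s 0≤t (0≤w zero) (≤.reflexive (sym w₀+sδ₀≈0))) ≱0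

  -- Colourful Carathéodory theorem for cones

  -- The vectors u i j, for varying j, are those of colour i, and the cone
  -- spanned by them contains b.
  module Colourful {n r} (u : Fin n → Fin r → Vec n) (b : Vec n)
                   (κ : Fin n → Vec r) (0≤κ : ∀ i j → 0# ≤ κ i j)
                   (b∈cone : ∀ i c → comb (κ i) (u i) c ≈ b c) where

    -- A choice of at most one vector of each colour; zero stands for no vector.
    -- Choices are encoded by numbers, since functions are not finitely many up
    -- to ≡ without extensionality.
    Choice : Set
    Choice = Fin (suc r ℕ.^ n)

    choice : Choice → Fin n → Fin (suc r)
    choice = finToFun

    _[_≔_] : Choice → Fin n → Fin (suc r) → Choice
    k [ i ≔ a ] = funToFin (updateAt (choice k) i (const a))

    choice-updates : ∀ k i a → choice (k [ i ≔ a ]) i ≡ a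
    choice-updates k i a = ≡.trans (Finₚ.finToFun-funToFin _ i) (updateAt-updates i (choice k))

    choice-minimal : ∀ k i a {j} → j ≢ i → choice (k [ i ≔ a ]) j ≡ choice k j
    choice-minimal k i a {j} j≢i =
      ≡.trans (Finₚ.finToFun-funToFin _ j) (updateAt-minimal j i (choice k) j≢i)

    -- Unused colours count as zero vectors.
    u⁺ : Fin n → Fin (suc r) → Vec n
    u⁺ i zero    = const 0#
    u⁺ i (suc j) = u i j

    chosen : Choice → Fin n → Vec n
    chosen k i = u⁺ i (choice k i)

    chosen-0 : ∀ k {i} → choice k i ≡ zero → ∀ c → chosen k i c ≈ 0#
    chosen-0 k {i} kᵢ≡0 c = reflexive (≡.cong (λ a → u⁺ i a c) kᵢ≡0)

    module P (k : Choice) = Projection (project (chosen k) b)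

    -- The squared distance from b to the span of the chosen vectors.
    dist² : Choice → Carrier
    dist² k = P.residual k ∙ P.residual k

    -- The point of that span nearest to b has nonnegative coefficients, so that
    -- it lies in the cone of the chosen vectors.
    Good : Choice → Set ℓ₂
    Good k = ∀ i → 0# ≤ P.weight k i

    -- b - ρ lies in the cone of the chosen vectors.
    record InCone (k : Choice) (ρ : Vec n) : Set (c ⊔ ℓ₁ ⊔ ℓ₂) where
      field
        weight    : Vec n
        nonneg    : ∀ i → 0# ≤ weight i
        supported : ∀ i → choice k i ≡ zero → weight i ≈ 0#
        decompose : ∀ c → b c ≈ comb weight (chosen k) c + ρ c

    Good⇒InCone : ∀ k → Good k → InCone k (P.residual k)
    Good⇒InCone k good = record
      { weight    = P.weight k
      ; nonneg    = good
      ; supported = λ i kᵢ≡0 → P.vanishing k i (chosen-0 k kᵢ≡0)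
      ; decompose = P.decompose k
      }

    -- k ⊏ l if the colours in use in k are strictly among those in use in l.
    _⊏_ : Choice → Choice → Set
    k ⊏ l = (∀ i → choice l i ≡ zero → choice k i ≡ zero)
          × ∃ λ i → choice k i ≡ zero × choice l i ≢ zero

    ⊏-isStrictPartialOrder : IsStrictPartialOrder _≡_ _⊏_
    ⊏-isStrictPartialOrder = record
      { isEquivalence = ≡.isEquivalence
      ; irrefl        = λ { ≡.refl (_ , i , kᵢ≡0 , kᵢ≢0) → kᵢ≢0 kᵢ≡0 }
      ; trans         = λ { (k⊆l , _) (l⊆m , i , lᵢ≡0 , mᵢ≢0) →
                            (λ j mⱼ≡0 → k⊆l j (l⊆m j mⱼ≡0)) , i , k⊆l i lᵢ≡0 , mᵢ≢0 }
      ; <-resp-≈      = ≡.resp₂ _⊏_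
      }

    -- k ≺ l if the choice k comes nearer to b than l.
    _≺_ : Choice → Choice → Set ℓ₂
    k ≺ l = dist² k < dist² l

    ≺-isStrictPartialOrder : IsStrictPartialOrder _≡_ _≺_
    ≺-isStrictPartialOrder = record
      { isEquivalence = ≡.isEquivalence
      ; irrefl        = λ { ≡.refl x<x → x<x ≤.refl }
      ; trans         = λ k≺l l≺m m≤k → l≺m (≤.trans m≤k (<⇒≤ k≺l))
      ; <-resp-≈      = ≡.resp₂ _≺_
      }

    -- From a point of the cone, move towards the point of the span that is
    -- nearest to b.  If that leaves the cone, then drop the vector of the facet
    -- through which the segment leaves, and repeat.
    relax : ∀ k → Acc _⊏_ k → ∀ {ρ} → InCone k ρ → ∃ λ l → Good l × dist² l ≤ ρ ∙ ρ
    relax k (acc rec) {ρ} F = descend (exit w δ F.nonneg)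
      where
      module F = InCone F

      w δ : Vec n
      w = F.weight
      δ i = P.weight k i + - 1# * w i

      y : Vec n
      y = comb δ (chosen k)

      -- The residual for s = 1 is ρ, and for s = 0 that of the nearest point.
      residual : Carrier → Vec n
      residual s c = P.residual k c + s * y c

      residual² : ∀ s → residual s ∙ residual s ≈ dist² k + s * s * y ∙ y
      residual² s = begin
        residual s ∙ residual s
          ≈⟨ norm²-+* (P.residual k) y s ⟩
        dist² k + (s * P.residual k ∙ y + s * P.residual k ∙ y) + s * s * y ∙ y
          ≈⟨ +-congʳ (+-congˡ (+-cong s*⊥ s*⊥)) ⟩
        dist² k + (0# + 0#) + s * s * y ∙ y
          ≈⟨ +-congʳ (trans (+-congˡ (+-identityˡ 0#)) (+-identityʳ _)) ⟩
        dist² k + s * s * y ∙ y ∎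
        where
        s*⊥ : s * P.residual k ∙ y ≈ 0#
        s*⊥ = *-zeroʳ-≈ s (∙-comb-⊥ (P.residual k) δ (chosen k) (P.residual⊥ k))

      y≈ : ∀ c → y c ≈ comb (P.weight k) (chosen k) c + - 1# * comb w (chosen k) c
      y≈ = comb-+* (P.weight k) w (chosen k) (- 1#)

      residual-1 : ∀ c → ρ c ≈ residual 1# c
      residual-1 c = begin
        ρ c
          ≈⟨ solve 2 (λ a x → x := a :+ x :+ :- a) refl (comb w (chosen k) c) (ρ c) ⟩
        comb w (chosen k) c + ρ c + - comb w (chosen k) c
          ≈⟨ +-congʳ (trans (sym (F.decompose c)) (P.decompose k c)) ⟩
        comb (P.weight k) (chosen k) c + P.residual k c + - comb w (chosen k) c
          ≈⟨ solve 3 (λ a x d → a :+ x :+ :- d := x :+ con (+ 1) :* (a :+ :- con (+ 1) :* d))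
               refl (comb (P.weight k) (chosen k) c) (P.residual k c) (comb w (chosen k) c) ⟩
        P.residual k c + 1# * (comb (P.weight k) (chosen k) c + - 1# * comb w (chosen k) c)
          ≈⟨ +-congˡ (*-congˡ (y≈ c)) ⟨
        residual 1# c ∎

      ρ² : ρ ∙ ρ ≈ dist² k + 1# * 1# * y ∙ y
      ρ² = trans (∙-cong residual-1 residual-1) (residual² 1#)

      dist²≤ρ² : dist² k ≤ ρ ∙ ρ
      dist²≤ρ² = ≤-resp refl (sym ρ²) (x≤x+y (*-nonneg (square-nonneg 1#) (norm²-nonneg y)))

      w+δ≈ : ∀ i → w i + 1# * δ i ≈ P.weight k i
      w+δ≈ i = solve 2 (λ w p → w :+ con (+ 1) :* (p :+ :- con (+ 1) :* w) := p) refl (w i) (P.weight k i)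

      descend : (∀ i → 0# ≤ δ i) ⊎ Exit w δ → ∃ λ l → Good l × dist² l ≤ ρ ∙ ρ
      descend (inj₁ 0≤δ) = k , good , dist²≤ρ²
        where
        good : Good k
        good i = ≤-resp refl (w+δ≈ i) (+-nonneg (F.nonneg i) (*-nonneg 0≤1 (0≤δ i)))
      descend (inj₂ e) with ≤.total 1# (Exit.t e)
      ... | inj₁ 1≤t = k , good , dist²≤ρ²
        where
        good : Good k
        good i = ≤-resp refl (w+δ≈ i) (+*-between 1≤t 0≤1 (F.nonneg i) (Exit.inside e i))
      ... | inj₂ t≤1 = let l , good , l≤ = relax k′ (rec k′⊏k) F′ in l , good , ≤.trans l≤ residual²≤ρ²
        where
        open Exit e

        k′ : Choice
        k′ = k [ i ≔ zero ]

        unused⇒δ≈0 : ∀ j → choice k j ≡ zero → δ j ≈ 0#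
        unused⇒δ≈0 j kⱼ≡0 = trans (+-cong (P.vanishing k j (chosen-0 k kⱼ≡0))
          (*-zeroʳ-≈ (- 1#) (F.supported j kⱼ≡0))) (+-identityʳ 0#)

        k′⊏k : k′ ⊏ k
        k′⊏k = unused , i , choice-updates k i zero , λ kᵢ≡0 → δᵢ<0 (≤.reflexive (sym (unused⇒δ≈0 i kᵢ≡0)))
          where
          unused : ∀ j → choice k j ≡ zero → choice k′ j ≡ zero
          unused j kⱼ≡0 with j Finₚ.≟ i
          ... | yes ≡.refl = choice-updates k j zero
          ... | no  j≢i    = ≡.trans (choice-minimal k i zero j≢i) kⱼ≡0

        w′ : Vec n
        w′ j = w j + t * δ j

        supported′ : ∀ j → choice k′ j ≡ zero → w′ j ≈ 0#
        supported′ j k′ⱼ≡0 with j Finₚ.≟ i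
        ... | yes ≡.refl = boundary
        ... | no  j≢i    = trans (+-cong (F.supported j kⱼ≡0) (*-zeroʳ-≈ t (unused⇒δ≈0 j kⱼ≡0))) (+-identityʳ 0#)
          where
          kⱼ≡0 : choice k j ≡ zero
          kⱼ≡0 = ≡.trans (≡.sym (choice-minimal k i zero j≢i)) k′ⱼ≡0

        w′-chosen : ∀ c j → w′ j * chosen k j c ≈ w′ j * chosen k′ j c
        w′-chosen c j with j Finₚ.≟ i
        ... | yes ≡.refl = trans (*-zeroˡ-≈ _ boundary) (sym (*-zeroˡ-≈ _ boundary))
        ... | no  j≢i    = *-congˡ (reflexive (≡.cong (λ a → u⁺ j a c) (≡.sym (choice-minimal k i zero j≢i))))

        F′ : InCone k′ (residual (1# - t))
        F′ = record
          { weight    = w′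
          ; nonneg    = inside
          ; supported = supported′
          ; decompose = λ c → begin
              b c                                                    ≈⟨ F.decompose c ⟩
              comb w (chosen k) c + ρ c                              ≈⟨ +-congˡ (residual-1 c) ⟩
              comb w (chosen k) c + residual 1# c
                ≈⟨ solve 4 (λ a x y t → a :+ (x :+ con (+ 1) :* y) := (a :+ t :* y) :+ (x :+ (con (+ 1) :- t) :* y))
                     refl (comb w (chosen k) c) (P.residual k c) (y c) t ⟩
              (comb w (chosen k) c + t * y c) + residual (1# - t) c  ≈⟨ +-congʳ (comb-+* w δ (chosen k) t c) ⟨
              comb w′ (chosen k) c + residual (1# - t) c             ≈⟨ +-congʳ (sum-cong-≋ (w′-chosen c)) ⟩
              comb w′ (chosen k′) c + residual (1# - t) c            ∎
          }

        residual²≤ρ² : residual (1# - t) ∙ residual (1# - t) ≤ ρ ∙ ρ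
        residual²≤ρ² = ≤-resp (sym (residual² (1# - t)))
          (trans (solve 3 (λ d y t → let s = con (+ 1) :- t in
                    (d :+ s :* s :* y) :+ (t :* s :+ t) :* y := d :+ con (+ 1) :* con (+ 1) :* y)
                    refl (dist² k) (y ∙ y) t) (sym ρ²))
          (x≤x+y (*-nonneg (+-nonneg (*-nonneg 0≤t (≤⇒0≤y-x t≤1)) 0≤t) (norm²-nonneg y)))

    -- Unless b is reached, some colour is not needed to represent the nearest
    -- point: if all colours are in use, then the n chosen vectors are orthogonal
    -- to the residual, and a linear dependence between them allows one weight to
    -- be reduced to 0.
    free-colour : ∀ k → Good k → ¬ (dist² k ≈ 0#) →
                  ∃ λ (F : InCone k (P.residual k)) → ∃ λ i → InCone.weight F i ≈ 0#
    free-colour k good d≉0 with Finₚ.any? (λ i → choice k i Finₚ.≟ zero)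
    ... | yes (i , kᵢ≡0) = F , i , InCone.supported F i kᵢ≡0
      where F = Good⇒InCone k good
    ... | no  allUsed with dependent-⊥ (P.residual k) (chosen k) d≉0 (P.residual⊥ k)
    ...   | δ , (i , δᵢ<0) , Σδ≈0 with exit (P.weight k) δ good
    ...     | inj₁ 0≤δ = contradiction (0≤δ i) δᵢ<0
    ...     | inj₂ e   = F , Exit.i e , Exit.boundary e
      where
      open Exit e using (t; inside)
      F : InCone k (P.residual k)
      F = record
        { weight    = λ j → P.weight k j + t * δ j
        ; nonneg    = inside
        ; supported = λ j kⱼ≡0 → contradiction (j , kⱼ≡0) allUsed
        ; decompose = λ c → trans (P.decompose k c) (+-congʳ (begin
            comb (P.weight k) (chosen k) c                               ≈⟨ +-identityʳ _ ⟨
            comb (P.weight k) (chosen k) c + 0#                          ≈⟨ +-congˡ (*-zeroʳ-≈ t (Σδ≈0 c)) ⟨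
            comb (P.weight k) (chosen k) c + t * comb δ (chosen k) c     ≈⟨ comb-+* (P.weight k) δ (chosen k) t c ⟨
            comb (λ j → P.weight k j + t * δ j) (chosen k) c             ∎))
        }

    -- As b lies in the cone of each colour, each colour has a vector on the
    -- same side as b of the hyperplane orthogonal to the residual, unless b is
    -- reached.
    improving : ∀ k → ¬ (dist² k ≈ 0#) → ∀ i → ∃ λ j → 0# < P.residual k ∙ u i j
    improving k d≉0 i with Finₚ.any? (λ j → ¬? (P.residual k ∙ u i j ≤.≤? 0#))
    ... | yes j,ρu>0 = j,ρu>0
    ... | no  none   = contradiction (≤.antisym d≤0 (norm²-nonneg ρ)) d≉0
      where
      ρ : Vec n
      ρ = P.residual k

      κρu≤0 : ∀ j → κ i j * ρ ∙ u i j ≤ 0#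
      κρu≤0 j = 0≤-⇒nonpos (≤-resp refl (sym (-‿distribʳ-* _ _)) (*-nonneg (0≤κ i j)
        (nonpos⇒0≤- (decidable-stable (ρ ∙ u i j ≤.≤? 0#) λ ρu>0 → none (j , ρu>0)))))

      ρ∙b : ρ ∙ comb (κ i) (u i) ≈ ρ ∙ (λ c → comb (P.weight k) (chosen k) c + ρ c)
      ρ∙b = ∙-cong {x = ρ} (λ _ → refl) (λ c → trans (b∈cone i c) (P.decompose k c))

      d≈ : sum (λ j → κ i j * ρ ∙ u i j) ≈ ρ ∙ ρ
      d≈ = begin
        sum (λ j → κ i j * ρ ∙ u i j)                     ≈⟨ ∙-comb ρ (κ i) (u i) ⟨
        ρ ∙ comb (κ i) (u i)                              ≈⟨ ρ∙b ⟩
        ρ ∙ (λ c → comb (P.weight k) (chosen k) c + ρ c)  ≈⟨ ∙-distribˡ-+ ρ _ ρ ⟩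
        ρ ∙ comb (P.weight k) (chosen k) + ρ ∙ ρ
          ≈⟨ +-congʳ (∙-comb-⊥ ρ (P.weight k) (chosen k) (P.residual⊥ k)) ⟩
        0# + ρ ∙ ρ                                        ≈⟨ +-identityˡ _ ⟩
        ρ ∙ ρ                                             ∎

      d≤0 : ρ ∙ ρ ≤ 0#
      d≤0 = ≤-resp d≈ refl (sum-nonpos κρu≤0)

    -- Use the vector of the free colour that points towards b.
    exchange : ∀ k → Good k → ¬ (dist² k ≈ 0#) → ∃ λ l → Good l × l ≺ k
    exchange k good d≉0 with free-colour k good d≉0
    ... | F , i , wᵢ≈0 with improving k d≉0 i
    ...   | j , 0<p = let l , good , l≤ = relax k′ (spo-wellFounded ⊏-isStrictPartialOrder k′) F′ in
                      l , good , λ k≤l → ρ′<ρ (≤.trans k≤l l≤)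
      where
      module F = InCone F

      ρ v : Vec n
      ρ = P.residual k
      v = u i j

      p : Carrier
      p = ρ ∙ v

      p≉0 : ¬ (p ≈ 0#)
      p≉0 p≈0 = 0<p (≤.reflexive p≈0)

      0<v² : 0# < v ∙ v
      0<v² v²≤0 = p≉0 (sum-0 λ c → *-zeroʳ-≈ (ρ c) (norm²-0 v (≤.antisym v²≤0 (norm²-nonneg v)) c))

      division : ∃ λ s → (s * v ∙ v ≈ p) × 0# ≤ s
      division = divide-nonneg (<⇒≤ 0<p) 0<v²

      -- With s = p / (v ∙ v), the vector ρ - s v has minimal norm on the ray from
      -- ρ in the direction - v.
      s : Carrier
      s = proj₁ division

      sv²≈p : s * v ∙ v ≈ p
      sv²≈p = proj₁ (proj₂ division)

      0≤s : 0# ≤ s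
      0≤s = proj₂ (proj₂ division)

      ρ′ : Vec n
      ρ′ c = ρ c + - s * v c

      ρ′² : ρ′ ∙ ρ′ ≈ ρ ∙ ρ - s * p
      ρ′² = begin
        ρ′ ∙ ρ′                                                  ≈⟨ norm²-+* ρ v (- s) ⟩
        ρ ∙ ρ + (- s * p + - s * p) + - s * - s * v ∙ v
          ≈⟨ solve 4 (λ d p s v → d :+ (:- s :* p :+ :- s :* p) :+ :- s :* :- s :* v :=
                                  d :+ (:- s :* p :+ :- s :* p) :+ s :* (s :* v))
               refl (ρ ∙ ρ) p s (v ∙ v) ⟩
        ρ ∙ ρ + (- s * p + - s * p) + s * (s * v ∙ v)            ≈⟨ +-congˡ (*-congˡ sv²≈p) ⟩
        ρ ∙ ρ + (- s * p + - s * p) + s * p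
          ≈⟨ solve 3 (λ d p s → d :+ (:- s :* p :+ :- s :* p) :+ s :* p := d :- s :* p) refl (ρ ∙ ρ) p s ⟩
        ρ ∙ ρ - s * p                                            ∎

      ρ′<ρ : ρ′ ∙ ρ′ < ρ ∙ ρ
      ρ′<ρ ρ²≤ρ′² = p≉0 (trans (sym sv²≈p) (*-zeroˡ-≈ _ s≈0))
        where
        sp≤0 : s * p ≤ 0#
        sp≤0 = 0≤-⇒nonpos (≤-resp refl
          (trans (+-congʳ ρ′²) (solve 2 (λ d x → d :- x :- d := :- x) refl (ρ ∙ ρ) (s * p)))
          (≤⇒0≤y-x ρ²≤ρ′²))
        s≈0 : s ≈ 0#
        s≈0 = *-cancel-0 p≉0 (trans (*-comm p s) (≤.antisym sp≤0 (*-nonneg 0≤s (<⇒≤ 0<p))))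

      k′ : Choice
      k′ = k [ i ≔ suc j ]

      w′ : Vec n
      w′ = updateAt F.weight i (const s)

      w′ᵢ≡s : w′ i ≡ s
      w′ᵢ≡s = updateAt-updates i F.weight

      w′-minimal : ∀ {l} → l ≢ i → w′ l ≡ F.weight l
      w′-minimal {l} l≢i = updateAt-minimal l i F.weight l≢i

      F′ : InCone k′ ρ′
      F′ = record
        { weight    = w′
        ; nonneg    = nonneg′
        ; supported = supported′
        ; decompose = λ c → begin
            b c                                             ≈⟨ F.decompose c ⟩
            comb F.weight (chosen k) c + ρ c
              ≈⟨ solve 4 (λ a x s v → a :+ x := (a :+ s :* v) :+ (x :+ :- s :* v)) refl _ (ρ c) s (v c) ⟩
            (comb F.weight (chosen k) c + s * v c) + ρ′ c   ≈⟨ +-congʳ (+-congˡ (newTerm c)) ⟨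
            (comb F.weight (chosen k) c + w′ i * chosen k′ i c) + ρ′ c
              ≈⟨ +-congʳ (sum-replace i (oldTerm c) (*-zeroˡ-≈ _ wᵢ≈0)) ⟨
            comb w′ (chosen k′) c + ρ′ c                    ∎
        }
        where
        nonneg′ : ∀ l → 0# ≤ w′ l
        nonneg′ l with l Finₚ.≟ i
        ... | yes ≡.refl = ≤-resp refl (reflexive (≡.sym w′ᵢ≡s)) 0≤s
        ... | no  l≢i    = ≤-resp refl (reflexive (≡.sym (w′-minimal l≢i))) (F.nonneg l)

        supported′ : ∀ l → choice k′ l ≡ zero → w′ l ≈ 0#
        supported′ l k′ₗ≡0 with l Finₚ.≟ i
        ... | yes ≡.refl = contradiction (≡.trans (≡.sym k′ₗ≡0) (choice-updates k l (suc j))) λ ()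
        ... | no  l≢i    = trans (reflexive (w′-minimal l≢i))
          (F.supported l (≡.trans (≡.sym (choice-minimal k i (suc j) l≢i)) k′ₗ≡0))

        newTerm : ∀ c → w′ i * chosen k′ i c ≈ s * v c
        newTerm c = *-cong (reflexive w′ᵢ≡s) (reflexive (≡.cong (λ a → u⁺ i a c) (choice-updates k i (suc j))))

        oldTerm : ∀ c l → l ≢ i → w′ l * chosen k′ l c ≈ F.weight l * chosen k l c
        oldTerm c l l≢i = *-cong (reflexive (w′-minimal l≢i))
          (reflexive (≡.cong (λ a → u⁺ l a c) (choice-minimal k i (suc j) l≢i)))

    reach : ∀ k → Acc _≺_ k → Good k → ∃ λ l → Good l × dist² l ≈ 0#
    reach k (acc rec) good with dist² k ≤.≟ 0#
    ... | yes d≈0 = k , good , d≈0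
    ... | no  d≉0 = let l , good , l≺k = exchange k good d≉0 in reach l (rec l≺k) good

    -- b lies in the cone of one vector of each colour; the vector j₀ serves for
    -- the unused colours.
    colourful : Fin r → ∃ λ (f : Fin n → Fin r) → ∃ λ w →
                (∀ i → 0# ≤ w i) × (∀ c → comb w (λ i → u i (f i)) c ≈ b c)
    colourful j₀ = select ∘ choice k , P.weight k , good , λ c → begin
        comb (P.weight k) (λ i → u i (select (choice k i))) c  ≈⟨ sum-cong-≋ (λ i → term i c (choice k i) ≡.refl) ⟩
        comb (P.weight k) (chosen k) c                         ≈⟨ +-identityʳ _ ⟨
        comb (P.weight k) (chosen k) c + 0#                    ≈⟨ +-congˡ (norm²-0 (P.residual k) d≈0 c) ⟨
        comb (P.weight k) (chosen k) c + P.residual k c        ≈⟨ P.decompose k c ⟨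
        b c                                                    ∎
      where
      ∅ : Choice
      ∅ = funToFin {n} {suc r} (const zero)

      initial : InCone ∅ b
      initial = record
        { weight    = const 0#
        ; nonneg    = λ _ → ≤.refl
        ; supported = λ _ _ → refl
        ; decompose = λ c → sym (trans (+-congʳ (sum-0 λ i → zeroˡ (chosen ∅ i c))) (+-identityˡ (b c)))
        }

      reached : ∃ λ l → Good l × dist² l ≈ 0#
      reached = let l , good , _ = relax ∅ (spo-wellFounded ⊏-isStrictPartialOrder ∅) initial in
                reach l (spo-wellFounded ≺-isStrictPartialOrder l) good

      k    = proj₁ reached
      good = proj₁ (proj₂ reached)
      d≈0  = proj₂ (proj₂ reached)

      select : Fin (suc r) → Fin r
      select zero    = j₀
      select (suc j) = j

      term : ∀ i c a → choice k i ≡ a → P.weight k i * u i (select a) c ≈ P.weight k i * u⁺ i a c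
      term i c zero    kᵢ≡0 = trans (*-zeroˡ-≈ _ wᵢ≈0) (sym (*-zeroˡ-≈ _ wᵢ≈0))
        where wᵢ≈0 = P.vanishing k i (chosen-0 k kᵢ≡0)
      term i c (suc j) _    = refl

  -- Tverberg's theorem

  -- The Kronecker delta.
  indicator : ∀ {r} → Fin r → Fin r → Carrier
  indicator j p = if does (j Finₚ.≟ p) then 1# else 0#

  indicator-≢ : ∀ {r} {j p : Fin r} → j ≢ p → indicator j p ≈ 0#
  indicator-≢ {j = j} {p} j≢p with j Finₚ.≟ p
  ... | yes j≡p = contradiction j≡p j≢p
  ... | no  _   = refl

  indicator-nonneg : ∀ {r} (j p : Fin r) → 0# ≤ indicator j p
  indicator-nonneg j p with j Finₚ.≟ p
  ... | yes _ = 0≤1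
  ... | no  _ = ≤.refl

  sum-indicator : ∀ {r} (p : Fin r) → sum (λ j → indicator j p) ≈ 1#
  sum-indicator {suc r} zero    = trans (+-congˡ (sum-0 {r} λ _ → refl)) (+-identityʳ 1#)
  sum-indicator {suc r} (suc p) = trans (+-identityˡ _) (sum-indicator p)

  -- Sarkaria's tensor product v j ⊗ a, where v 0 = (-1, ..., -1) and v j is the
  -- j-th unit vector for j > 0.  As 0 = v 0 + ... + v r is the only linear
  -- relation between the v j, a sum of v j ⊗ a j vanishes iff all a j are equal.
  -- The additional coordinate, listed first, is 1 for j = 0 and 0 for j > 0.
  tensor : ∀ {r e} → Vec e → Fin (suc r) → Vec (suc (r ℕ.* e))
  tensor             a j zero    = indicator j zero
  tensor {r} {e} a j (suc k) =
    (indicator j (suc (quotient e k)) - indicator j zero) * a (remainder {r} e k)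

  tensor-combine : ∀ {r e} (a : Vec e) (j : Fin (suc r)) p q →
                   tensor a j (suc (combine p q)) ≡ (indicator j (suc p) - indicator j zero) * a q
  tensor-combine a j p q =
    ≡.cong (λ (p , q) → (indicator j (suc p) - indicator j zero) * a q) (Finₚ.remQuot-combine p q)

  sum-tensor : ∀ {r e} (a : Vec e) c →
               comb (const 1#) (tensor {r} a) c ≈ (1# ∷ const 0#) c
  sum-tensor {r} a zero    = trans (sum-cong-≋ {suc r} λ j → *-identityˡ (indicator j zero))
                                   (sum-indicator {suc r} zero)
  sum-tensor {r} {e} a (suc k) = begin
    sum (λ j → 1# * ((x j - y j) * a q))
      ≈⟨ sum-cong-≋ (λ j → solve 3 (λ x y a → con (+ 1) :* ((x :- y) :* a) := a :* x :+ :- a :* y)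
           refl (x j) (y j) (a q)) ⟩
    sum (λ j → a q * x j + - a q * y j)
      ≈⟨ ∑-distrib-+ (λ j → a q * x j) (λ j → - a q * y j) ⟩
    sum (λ j → a q * x j) + sum (λ j → - a q * y j)
      ≈⟨ +-cong (*-distribˡ-sum (a q) x) (*-distribˡ-sum (- a q) y) ⟨
    a q * sum x + - a q * sum y
      ≈⟨ +-cong (*-congˡ (sum-indicator p)) (*-congˡ (sum-indicator {suc r} zero)) ⟩
    a q * 1# + - a q * 1#
      ≈⟨ solve 1 (λ a → a :* con (+ 1) :+ :- a :* con (+ 1) := con (+ 0)) refl (a q) ⟩
    0# ∎
    where
    p : Fin (suc r)
    p = suc (quotient e k)
    q : Fin e
    q = remainder {r} e k
    x y : Vec (suc r)
    x j = indicator j p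
    y j = indicator j zero

  module _ {d r} (X : PointSet ℝ d (suc (r ℕ.* (d ℕ.+ 1)))) where
    open PointSet X

    n : ℕ
    n = suc (r ℕ.* (d ℕ.+ 1))

    -- Homogeneous coordinates.
    lift : Fin n → Vec (d ℕ.+ 1)
    lift i = point i ++ const 1#

    -- The cones are those of the vectors v j ⊗ lift i, with the weights 1.
    open Colourful {n} {suc r} (λ i → tensor (lift i)) (1# ∷ const 0#) (λ _ _ → 1#) (λ _ _ → 0≤1)
                   (λ i → sum-tensor (lift i))
      using (colourful)

    -- The part of a point is the index of the vector chosen for it.
    partition-by : (f : Fin n → Fin (suc r)) (w : Vec n) → (∀ i → 0# ≤ w i) →
                   (∀ c → comb w (λ i → tensor (lift i) (f i)) c ≈ (1# ∷ const 0#) c) →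
                   Divisible ℝ (suc r) X
    partition-by f w 0≤w Σ≈b = part , record { disjoint = disjoint ; covers = covers } , z , inConv
      where
      part : Fin (suc r) → Subset n
      part p = tabulate λ i → does (f i Finₚ.≟ p)

      ∈part : ∀ i → i ∈ part (f i)
      ∈part i = lookup⇒[]= i (part (f i)) (≡.trans
        (lookup∘tabulate (λ j → does (f j Finₚ.≟ f i)) i) (dec-true (f i Finₚ.≟ f i) ≡.refl))

      ∈part⇒≡ : ∀ {i p} → i ∈ part p → f i ≡ p
      ∈part⇒≡ {i} {p} i∈p
        with f i Finₚ.≟ p
           | ≡.trans (≡.sym (lookup∘tabulate (λ i → does (f i Finₚ.≟ p)) i)) ([]=⇒lookup i∈p)
      ... | yes fᵢ≡p | _  = fᵢ≡p
      ... | no  _    | ()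

      disjoint : ∀ {p q} → p ≢ q → Empty (part p ∩ part q)
      disjoint {p} {q} p≢q (i , i∈) =
        let i∈p , i∈q = x∈p∩q⁻ (part p) (part q) i∈ in
        p≢q (≡.trans (≡.sym (∈part⇒≡ i∈p)) (∈part⇒≡ i∈q))

      covers : ∀ i → ∃ λ p → i ∈ part p
      covers i = f i , ∈part i

      weight : Fin (suc r) → Vec n
      weight p i = w i * indicator (f i) p

      -- The common point of the convex hulls.
      z : Point ℝ d
      z j = sum λ i → weight zero i * point i j

      -- The weighted sums of the lifted points agree for all parts.
      agree : ∀ p q → comb (weight p) lift q ≈ comb (weight zero) lift q
      agree zero    q = refl
      agree (suc p) q = begin
        comb (weight (suc p)) lift q
          ≈⟨ sum-cong-≋ (λ i → solve 4 (λ w x y a → w :* x :* a := w :* ((x :- y) :* a) :+ w :* y :* a)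
               refl (w i) (indicator (f i) (suc p)) (indicator (f i) zero) (lift i q)) ⟩
        sum (λ i → tensorTerm i + weight zero i * lift i q)
          ≈⟨ ∑-distrib-+ tensorTerm (λ i → weight zero i * lift i q) ⟩
        sum tensorTerm + comb (weight zero) lift q
          ≈⟨ +-congʳ (sum-cong-≋ λ i → *-congˡ {w i} (reflexive (tensor-combine (lift i) (f i) p q))) ⟨
        comb w (λ i → tensor (lift i) (f i)) (suc (combine p q)) + comb (weight zero) lift q
          ≈⟨ +-congʳ (Σ≈b (suc (combine p q))) ⟩
        0# + comb (weight zero) lift q
          ≈⟨ +-identityˡ _ ⟩
        comb (weight zero) lift q ∎
        where
        tensorTerm : Vec n
        tensorTerm i = w i * ((indicator (f i) (suc p) - indicator (f i) zero) * lift i q)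

      total : ∀ p → sum (weight p) ≈ 1#
      total p = begin
        sum (weight p)                            ≈⟨ sum-lift p ⟨
        comb (weight p) lift (d ↑ʳ zero)          ≈⟨ agree p (d ↑ʳ zero) ⟩
        comb (weight zero) lift (d ↑ʳ zero)       ≈⟨ sum-lift zero ⟩
        sum (weight zero)                         ≈⟨ Σ≈b zero ⟩
        1#                                        ∎
        where
        sum-lift : ∀ p → comb (weight p) lift (d ↑ʳ zero) ≈ sum (weight p)
        sum-lift p = sum-cong-≋ λ i → trans
          (*-congˡ {weight p i} (reflexive (lookup-++ʳ {n = 1} (point i) (const 1#) zero))) (*-identityʳ _)

      inConv : ∀ p → InConv ℝ X (part p) z
      inConv p = record
        { weight      = weight p
        ; nonneg      = λ i → *-nonneg (0≤w i) (indicator-nonneg (f i) p)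
        ; supported   = λ {i} i∉p → *-zeroʳ-≈ (w i) (indicator-≢ {j = f i} {p} λ { ≡.refl → i∉p (∈part i) })
        ; total       = total p
        ; combination = λ j → begin
            z j                                   ≈⟨ point≈lift zero j ⟨
            comb (weight zero) lift (j ↑ˡ 1)      ≈⟨ agree p (j ↑ˡ 1) ⟨
            comb (weight p) lift (j ↑ˡ 1)         ≈⟨ point≈lift p j ⟩
            sum (λ i → weight p i * point i j)    ∎
        }
        where
        point≈lift : ∀ p j → comb (weight p) lift (j ↑ˡ 1) ≈ sum (λ i → weight p i * point i j)
        point≈lift p j = sum-cong-≋ λ i →
          *-congˡ {weight p i} (reflexive (lookup-++ˡ {n = 1} (point i) (const 1#) j))

    tverberg : Divisible ℝ (suc r) X
    tverberg = let f , w , 0≤w , Σ≈b = colourful zero in partition-by f w 0≤w Σ≈b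

open import Data.Nat.Base using (_+_; _*_; _∸_; _≤_)

theorem1p2 : ∀ {c ℓ₁ ℓ₂} (ℝ : RealNumbers c ℓ₁ ℓ₂) (d r n : ℕ) →
    2 ≤ d → 3 ≤ r → n ≡ (r ∸ 1) * (d + 1) + 1 →
    (X : PointSet ℝ d n) → AGeneralPosition ℝ X → Divisible ℝ r X
theorem1p2 ℝ d (suc r) n _ _ n≡ X _ with ≡.trans n≡ (ℕₚ.+-comm (r * (d + 1)) 1)
... | ≡.refl = tverberg ℝ X
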